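{- Let $G=(V,E)$ be a connected claw-free graph with clique number $\omega(G)=4$. Then one of the following is true: (i) $G$ is the line graph $L(F)$ of a graph $F$ of maximum degree $4$; or (ii) there exists $v\in V$ with $\deg_{G^2}(v)\le 19$ such that the set of all vertices $x\in N_G(v)$ with $\deg_{G^2}(x)\ge 21$ induces a clique in $(G\setminus v)^2$.
   Context: A graph is claw-free if it has no induced $K_{1,3}$. The square $H^2$ of a graph $H$ is the graph on $V(H)$ in which two distinct vertices are adjacent iff they are at distance at most $2$ in $H$. $\deg_{G^2}(v)$ is the degree of $v$ in $G^2$; $N_G(v)$ is the open neighbourhood of $v$ in $G$; $G\setminus v$ is $G$ with $v$ deleted. -}

module Defs where

open import Data.Nat using (ℕ; zero; suc; _+_; _≤_)
open import Data.Fin using (Fin; zero; suc)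
open import Data.Bool using (Bool; true; false; T; _∧_; _∨_; not)
open import Data.Product using (Σ; ∃; _×_; _,_; proj₁; proj₂)
open import Data.Sum using (_⊎_)
open import Relation.Binary.PropositionalEquality using (_≡_; _≢_)
open import Relation.Nullary using (¬_)
open import Function.Definitions using (Injective)

record Graph (n : ℕ) : Set where
  field
    adj    : Fin n → Fin n → Bool
    sym    : ∀ u v → adj u v ≡ adj v u
    irrefl : ∀ v → adj v v ≡ false
open Graph public

Adj : ∀ {n} → Graph n → Fin n → Fin n → Set
Adj G u v = T (adj G u v)

bool→ℕ : Bool → ℕ
bool→ℕ true  = 1
bool→ℕ false = 0

count : ∀ {n} → (Fin n → Bool) → ℕ
count {zero}  p = 0
count {suc n} p = bool→ℕ (p zero) + count (λ i → p (suc i))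

anyFin : ∀ {n} → (Fin n → Bool) → Bool
anyFin {zero}  p = false
anyFin {suc n} p = p zero ∨ anyFin (λ i → p (suc i))

eqFin : ∀ {n} → Fin n → Fin n → Bool
eqFin zero    zero    = true
eqFin zero    (suc _) = false
eqFin (suc _) zero    = false
eqFin (suc i) (suc j) = eqFin i j

sqAdj : ∀ {n} → Graph n → Fin n → Fin n → Bool
sqAdj G u v = not (eqFin u v) ∧ (adj G u v ∨ anyFin (λ w → adj G u w ∧ adj G w v))

degSq : ∀ {n} → Graph n → Fin n → ℕ
degSq G v = count (sqAdj G v)

-- adjacency in (G \ v)² between two vertices x y (both different from v):
-- distinct and at distance ≤ 2 in G \ v
sqDelAdj : ∀ {n} → Graph n → Fin n → Fin n → Fin n → Set
sqDelAdj G v x y =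
  x ≢ y × (Adj G x y ⊎ Σ (Fin _) λ w → w ≢ v × Adj G x w × Adj G w y)

data Reach {n} (G : Graph n) : Fin n → Fin n → Set where
  here : ∀ {u} → Reach G u u
  step : ∀ {u w v} → Adj G u w → Reach G w v → Reach G u v

Connected : ∀ {n} → Graph n → Set
Connected G = ∀ u v → Reach G u v

HasClique : ∀ {n} → Graph n → ℕ → Set
HasClique {n} G k =
  Σ (Fin k → Fin n) λ f → Injective _≡_ _≡_ f × (∀ i j → i ≢ j → Adj G (f i) (f j))

CliqueNumber : ∀ {n} → Graph n → ℕ → Set
CliqueNumber G k = HasClique G k × ¬ HasClique G (suc k)

ClawFree : ∀ {n} → Graph n → Set
ClawFree {n} G = ¬ (Σ (Fin n) λ c → Σ (Fin n) λ a → Σ (Fin n) λ b → Σ (Fin n) λ d →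
  Adj G c a × Adj G c b × Adj G c d ×
  a ≢ b × a ≢ d × b ≢ d ×
  ¬ Adj G a b × ¬ Adj G a d × ¬ Adj G b d)

deg : ∀ {m} → Graph m → Fin m → ℕ
deg F a = count (adj F a)

MaxDegree : ∀ {m} → Graph m → ℕ → Set
MaxDegree {m} F k = (∀ a → deg F a ≤ k) × Σ (Fin m) λ a → deg F a ≡ k

SameEdge : ∀ {m} → Fin m × Fin m → Fin m × Fin m → Set
SameEdge (a , b) (c , d) = (a ≡ c × b ≡ d) ⊎ (a ≡ d × b ≡ c)

ShareEnd : ∀ {m} → Fin m × Fin m → Fin m × Fin m → Set
ShareEnd (a , b) (c , d) = a ≡ c ⊎ a ≡ d ⊎ b ≡ c ⊎ b ≡ d

IsLineGraphOf : ∀ {n m} → Graph n → Graph m → Set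
IsLineGraphOf {n} {m} G F = Σ (Fin n → Fin m × Fin m) λ φ →
  (∀ x → Adj F (proj₁ (φ x)) (proj₂ (φ x))) ×
  (∀ a b → Adj F a b → Σ (Fin n) λ x → SameEdge (φ x) (a , b)) ×
  (∀ x y → SameEdge (φ x) (φ y) → x ≡ y) ×
  (∀ x y → Adj G x y → x ≢ y × ShareEnd (φ x) (φ y)) ×
  (∀ x y → x ≢ y → ShareEnd (φ x) (φ y) → Adj G x y)

{-# OPTIONS --safe #-}
-- Call an edge vw tight if the common neighbours of v and w form a clique, and
-- loose otherwise. For w in N(v), the neighbours of w outside N[v] form a clique
-- of at most 3 vertices, and if vw is loose each of them has a second neighbour in
-- N(v). Hence, with d = deg v and t tight edges at v, the second neighbourhood has
-- at most 3(d + t)/2 vertices. Together with a cruder bound for d ≥ 8 this shows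
-- that deg_{G²}(v) ≥ 20 forces d = 5 with all edges at v tight, or d = 6 with at
-- most two loose ones, and that deg_{G²}(v) ≥ 21 forces d = 6.
--
-- If (ii) fails at every vertex, then every N(v) is the disjoint union of two
-- cliques, each containing a tight neighbour without neighbours in the other
-- clique: either deg_{G²}(v) ≥ 20, or v has two neighbours violating (ii), and
-- these play the role of the tight neighbours. A tight edge vw spans the line
-- N[v] ∩ N[w], and the crux is that every vertex of a line L is tight with another
-- vertex of L: otherwise a vertex of square degree at least 21 would have three
-- loose neighbours. So each vertex lies on exactly two lines, the lines cover all
-- edges, and G is the line graph of the graph whose vertices are the lines.
module Submission where

open import Defs hiding (sym)
open import Data.Nat using (ℕ; zero; suc; _+_; _*_; _^_; _≤_; _<_; _≥_; z≤n; s≤s; s≤s⁻¹)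
open import Data.Nat.Properties using (≤-refl; ≤-reflexive; ≤-trans; ≤-antisym; +-mono-≤; +-monoˡ-≤; +-monoʳ-≤; *-monoʳ-≤; *-cancelˡ-≤; *-identityʳ; *-zeroʳ; *-distribˡ-+; +-cancelˡ-≤; m≤m+n; m≤n+m; _≤?_; ≰⇒>; ≮⇒≥; <⇒≱; +-0-commutativeMonoid; module ≤-Reasoning)
open import Data.Nat.Tactic.RingSolver using (solve-∀)
open import Algebra.Properties.CommutativeMonoid.Sum +-0-commutativeMonoid using (sum; ∑-comm; ∑-distrib-+)
open import Data.Fin using (Fin; zero; suc; funToFin; finToFun; combine)
open import Data.Fin.Patterns using (0F; 1F; 2F; 3F)
open import Data.Fin.Properties using (_≟_; any?; suc-injective; finToFun-funToFin)
open import Data.Bool using (Bool; true; false; T; not)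
open import Data.Bool.Properties using (T-∧; T-∨; T?)
open import Data.List using (List; []; _∷_; length)
open import Data.List.Relation.Unary.All using (All; []; _∷_; zipWith)
open import Data.List.Relation.Unary.AllPairs using ([]; _∷_)
open import Data.List.Relation.Unary.Unique.Propositional using (Unique)
open import Data.Product using (Σ; ∃; _×_; _,_; proj₁; proj₂; swap)
open import Data.Sum using (_⊎_; inj₁; inj₂; [_,_]′) renaming (map₁ to ⊎-map₁; map₂ to ⊎-map₂; swap to ⊎-swap)
open import Data.Empty using (⊥; ⊥-elim)
open import Function using (_∘_; id; _⇔_; mk⇔; Equivalence)
open import Function.Definitions using (Injective)
open import Function.Properties.Equivalence using () renaming (trans to ⇔-trans)
open import Level using (0ℓ)
open import Relation.Binary.PropositionalEquality using (_≡_; _≢_; refl; sym; trans; cong; cong₂; subst; _≗_)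
open import Relation.Nullary using (¬_; Dec; yes; no; does; contradiction)
open import Relation.Nullary.Decidable using (_×-dec_; _⊎-dec_; ¬?; decidable-stable; dec-false; does-⇔; from-no)
open import Relation.Unary using (Pred; Decidable)

-- Counting decidable predicates on Fin n

ind : {A : Set} → Dec A → ℕ
ind a? = bool→ℕ (does a?)

private variable
  m n k l : ℕ
  P Q R   : Pred (Fin n) 0ℓ

-- Counting through `does` makes `degSq` and `deg root` instances of `cnt` by computation, since
-- `does (T? b)` is `b`.
cnt : {P : Pred (Fin n) 0ℓ} → Decidable P → ℕ
cnt P? = count (λ i → does (P? i))

cnt≡sum : (P? : Decidable P) → cnt P? ≡ sum (λ i → ind (P? i))
cnt≡sum {zero}  P? = refl
cnt≡sum {suc n} P? = cong (ind (P? zero) +_) (cnt≡sum (P? ∘ suc))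

sum-mono-≤ : {f g : Fin n → ℕ} → (∀ i → f i ≤ g i) → sum f ≤ sum g
sum-mono-≤ {zero}  f≤g = z≤n
sum-mono-≤ {suc n} f≤g = +-mono-≤ (f≤g zero) (sum-mono-≤ (f≤g ∘ suc))

sum-*ˡ : ∀ k (f : Fin n → ℕ) → sum (λ i → k * f i) ≡ k * sum f
sum-*ˡ {zero}  k f = sym (*-zeroʳ k)
sum-*ˡ {suc n} k f = trans (cong (k * f zero +_) (sum-*ˡ k (f ∘ suc))) (sym (*-distribˡ-+ k (f zero) _))

cnt-cover : (P? : Decidable P) (Q? : Decidable Q) (R? : Decidable R) →
            (∀ i → P i → Q i ⊎ R i) → cnt P? ≤ cnt Q? + cnt R?
cnt-cover P? Q? R? P⊆ rewrite cnt≡sum P? | cnt≡sum Q? | cnt≡sum R?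
  | sym (∑-distrib-+ (ind ∘ Q?) (ind ∘ R?)) = sum-mono-≤ pointwise
  where
  pointwise : ∀ i → ind (P? i) ≤ ind (Q? i) + ind (R? i)
  pointwise i with P? i | Q? i | R? i
  ... | no  _ | _     | _     = z≤n
  ... | yes _ | yes _ | _     = s≤s z≤n
  ... | yes _ | no  _ | yes _ = s≤s z≤n
  ... | yes p | no ¬q | no ¬r = ⊥-elim ([ ¬q , ¬r ]′ (P⊆ i p))

cnt-disjoint : (P? : Decidable P) (Q? : Decidable Q) (R? : Decidable R) →
               (∀ i → Q i → P i) → (∀ i → R i → P i) → (∀ i → Q i → ¬ R i) →
               cnt Q? + cnt R? ≤ cnt P?
cnt-disjoint P? Q? R? Q⊆P R⊆P disj rewrite cnt≡sum P? | cnt≡sum Q? | cnt≡sum R?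
  | sym (∑-distrib-+ (ind ∘ Q?) (ind ∘ R?)) = sum-mono-≤ pointwise
  where
  pointwise : ∀ i → ind (Q? i) + ind (R? i) ≤ ind (P? i)
  pointwise i with P? i | Q? i | R? i
  ... | _     | yes q | yes r = ⊥-elim (disj i q r)
  ... | _     | no  _ | no  _ = z≤n
  ... | yes _ | yes _ | no  _ = ≤-refl
  ... | yes _ | no  _ | yes _ = ≤-refl
  ... | no ¬p | yes q | no  _ = contradiction (Q⊆P i q) ¬p
  ... | no ¬p | no  _ | yes r = contradiction (R⊆P i r) ¬p

cnt-mono : (P? : Decidable P) (Q? : Decidable Q) → (∀ i → P i → Q i) → cnt P? ≤ cnt Q?
cnt-mono P? Q? P⊆Q rewrite cnt≡sum P? | cnt≡sum Q? = sum-mono-≤ pointwise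
  where
  pointwise : ∀ i → ind (P? i) ≤ ind (Q? i)
  pointwise i with P? i | Q? i
  ... | no  _ | _     = z≤n
  ... | yes _ | yes _ = ≤-refl
  ... | yes p | no ¬q = contradiction (P⊆Q i p) ¬q

cnt≥1 : (P? : Decidable P) → ∀ i → P i → 1 ≤ cnt P?
cnt≥1 P? zero p with P? zero
... | yes _ = s≤s z≤n
... | no ¬p = contradiction p ¬p
cnt≥1 P? (suc i) p = ≤-trans (cnt≥1 (P? ∘ suc) i p) (m≤n+m _ _)

Without : Fin n → Pred (Fin n) 0ℓ → Pred (Fin n) 0ℓ
Without z P i = i ≢ z × P i

without? : (z : Fin n) → Decidable P → Decidable (Without z P)
without? z P? i = ¬? (i ≟ z) ×-dec P? i

cnt-remove : (P? : Decidable P) → ∀ z → P z → suc (cnt (without? z P?)) ≤ cnt P?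
cnt-remove {P = P} P? z p = ≤-trans (+-monoˡ-≤ _ (cnt≥1 (_≟ z) z refl))
  (cnt-disjoint P? (_≟ z) (without? z P?)
     (λ { _ refl → p }) (λ _ → proj₂) (λ _ i≡z (i≢z , _) → i≢z i≡z))

cnt≥length : (P? : Decidable P) (xs : List (Fin n)) → Unique xs → All P xs → length xs ≤ cnt P?
cnt≥length P? []       _        _        = z≤n
cnt≥length P? (x ∷ xs) (x∉ ∷ u) (p ∷ ps) = ≤-trans
  (s≤s (cnt≥length (without? x P?) xs u (zipWith (λ (x≢y , q) → (x≢y ∘ sym) , q) (x∉ , ps))))
  (cnt-remove P? x p)

cnt≥2 : (P? : Decidable P) → ∀ {x y} → x ≢ y → P x → P y → 2 ≤ cnt P?
cnt≥2 P? x≢y p q = cnt≥length P? (_ ∷ _ ∷ []) ((x≢y ∷ []) ∷ [] ∷ []) (p ∷ q ∷ [])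

cnt≥3 : (P? : Decidable P) → ∀ {x y z} → x ≢ y → x ≢ z → y ≢ z → P x → P y → P z → 3 ≤ cnt P?
cnt≥3 P? x≢y x≢z y≢z p q r =
  cnt≥length P? (_ ∷ _ ∷ _ ∷ []) ((x≢y ∷ x≢z ∷ []) ∷ (y≢z ∷ []) ∷ [] ∷ []) (p ∷ q ∷ r ∷ [])

pick : (P? : Decidable P) → k ≤ cnt P? → Σ (Fin k → Fin n) λ f → Injective _≡_ _≡_ f × (∀ i → P (f i))
pick {k = zero} P? _ = (λ ()) , (λ { {()} }) , λ ()
pick {zero} {k = suc k} P? ()
pick {suc n} {P = P} {k = suc k} P? le with P? zero | le
... | yes p | s≤s le′ with f , inj , ok ← pick (P? ∘ suc) le′ = g , g-inj , g-ok
  where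
  g : Fin (suc k) → Fin (suc n)
  g zero    = zero
  g (suc i) = suc (f i)
  g-inj : Injective _≡_ _≡_ g
  g-inj {zero}  {zero}  _  = refl
  g-inj {suc i} {suc j} eq = cong suc (inj (suc-injective eq))
  g-ok : ∀ i → P (g i)
  g-ok zero    = p
  g-ok (suc i) = ok i
... | no _ | le′ with f , inj , ok ← pick (P? ∘ suc) le′ = suc ∘ f , inj ∘ suc-injective , ok

pick₁ : (P? : Decidable P) → 1 ≤ cnt P? → ∃ P
pick₁ P? le with f , _ , ok ← pick P? le = f 0F , ok 0F

pick₂ : (P? : Decidable P) → 2 ≤ cnt P? → Σ (Fin _) λ x → Σ (Fin _) λ y → x ≢ y × P x × P y
pick₂ P? le with f , inj , ok ← pick P? le =
  f 0F , f 1F , (λ eq → contradiction (inj eq) λ ()) , ok 0F , ok 1F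

cnt-≟ : (w : Fin n) → cnt (_≟ w) ≤ 1
cnt-≟ w = ≮⇒≥ λ lt → let x , y , x≢y , x≡w , y≡w = pick₂ (_≟ w) lt in x≢y (trans x≡w (sym y≡w))

all⊎any : (∀ i → P i ⊎ Q i) → (∀ i → P i) ⊎ ∃ Q
all⊎any {zero} _ = inj₁ λ ()
all⊎any {suc n} h with h zero | all⊎any (h ∘ suc)
... | inj₂ q | _             = inj₂ (zero , q)
... | inj₁ _ | inj₂ (i , q)  = inj₂ (suc i , q)
... | inj₁ p | inj₁ ps       = inj₁ λ { zero → p ; (suc i) → ps i }

does⁺ : {A : Set} (a? : Dec A) → A → T (does a?)
does⁺ (yes _) _ = _
does⁺ (no ¬a) a = ¬a a

does⁻ : {A : Set} (a? : Dec A) → T (does a?) → A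
does⁻ (yes a) _ = a

-- Subsets of Fin n coded as elements of Fin (2 ^ n)

private
  digit : Bool → Fin 2
  digit false = 0F
  digit true  = 1F

  digit-injective : ∀ b c → digit b ≡ digit c → b ≡ c
  digit-injective false false _ = refl
  digit-injective true  true  _ = refl

funToFin-cong : {f g : Fin m → Fin n} → f ≗ g → funToFin f ≡ funToFin g
funToFin-cong {zero}  f≗g = refl
funToFin-cong {suc m} f≗g = cong₂ combine (f≗g zero) (funToFin-cong (f≗g ∘ suc))

-- Lines will be compared for equality and will serve as vertices of a `Graph`, so a subset becomes
-- a number with its characteristic function as binary digits.
code : {P : Pred (Fin n) 0ℓ} → Decidable P → Fin (2 ^ n)
code P? = funToFin (λ i → digit (does (P? i)))

code-cong : (P? : Decidable P) (Q? : Decidable Q) → (∀ i → P i ⇔ Q i) → code P? ≡ code Q?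
code-cong P? Q? P⇔Q = funToFin-cong λ i → cong digit (does-⇔ (P⇔Q i) (P? i) (Q? i))

code-injective : (P? : Decidable P) (Q? : Decidable Q) → code P? ≡ code Q? → ∀ {i} → P i → Q i
code-injective P? Q? eq {i} p = does⁻ (Q? i) (subst T (digit-injective _ _ digits) (does⁺ (P? i) p))
  where
  digits = trans (sym (finToFun-funToFin (digit ∘ does ∘ P?) i))
             (trans (cong (λ c → finToFun c i) eq) (finToFun-funToFin (digit ∘ does ∘ Q?) i))

-- Double counting

sum≥ : ∀ k (P? : Decidable P) (f : Fin n → ℕ) → (∀ i → P i → k ≤ f i) → k * cnt P? ≤ sum f
sum≥ k P? f k≤ rewrite cnt≡sum P? | sym (sum-*ˡ k (ind ∘ P?)) = sum-mono-≤ pointwise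
  where
  pointwise : ∀ i → k * ind (P? i) ≤ f i
  pointwise i with P? i
  ... | yes p rewrite *-identityʳ k = k≤ i p
  ... | no  _ rewrite *-zeroʳ k     = z≤n

-- Exchanging the sums counts the pairs of `E` by `w`: each `w` in `Q` contributes at most `l`, the
-- others nothing.
sum-cnt≤ : ∀ l {E : Fin m → Fin n → Set} (E? : ∀ w → Decidable (E w)) (Q? : Decidable Q) →
           (∀ w s → E w s → Q w) → (∀ w → Q w → cnt (E? w) ≤ l) →
           sum (λ s → cnt (λ w → E? w s)) ≤ l * cnt Q?
sum-cnt≤ {m} {n} l E? Q? E⊆Q ≤l = begin
  sum (λ s → cnt (λ w → E? w s))           ≤⟨ sum-mono-≤ (λ s → ≤-reflexive (cnt≡sum (λ w → E? w s))) ⟩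
  sum (λ s → sum (λ w → ind (E? w s)))     ≡⟨ ∑-comm (λ s w → ind (E? w s)) ⟩
  sum (λ w → sum (λ s → ind (E? w s)))     ≤⟨ sum-mono-≤ pointwise ⟩
  sum (λ w → l * ind (Q? w))               ≡⟨ sum-*ˡ l (ind ∘ Q?) ⟩
  l * sum (ind ∘ Q?)                       ≡⟨ cong (l *_) (cnt≡sum Q?) ⟨
  l * cnt Q?                               ∎
  where
  open ≤-Reasoning
  cnt-none : (P? : Decidable P) → (∀ i → ¬ P i) → cnt P? ≤ 0
  cnt-none P? ¬P = ≮⇒≥ λ lt → let i , p = pick₁ P? lt in ¬P i p
  pointwise : ∀ w → sum (λ s → ind (E? w s)) ≤ l * ind (Q? w)
  pointwise w rewrite sym (cnt≡sum (E? w)) with Q? w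
  ... | yes q rewrite *-identityʳ l = ≤l w q
  ... | no ¬q rewrite *-zeroʳ l     = cnt-none (E? w) (λ s e → ¬q (E⊆Q w s e))

double-count : ∀ k l {E : Fin m → Fin n → Set} (E? : ∀ w → Decidable (E w)) (P? : Decidable P) (Q? : Decidable Q) →
  (∀ s → P s → k ≤ cnt (λ w → E? w s)) → (∀ w s → E w s → Q w) → (∀ w → Q w → cnt (E? w) ≤ l) →
  k * cnt P? ≤ l * cnt Q?
double-count k l E? P? Q? k≤ E⊆Q ≤l = ≤-trans (sum≥ k P? _ k≤) (sum-cnt≤ l E? Q? E⊆Q ≤l)

private
  -- The 40 is twice the square degree 20, and the sum is the bound of `degSq-bound`. It reaches at
  -- most 32 for `d ≤ 4`; for `d = 5` it needs `t = 5`; for `d = 6` three tight edges give only 39.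
  size-cases : ∀ d t → d ≤ 6 → t ≤ d → 40 ≤ 5 * d + 3 * t → (d ≡ 5 × 5 ≤ t) ⊎ (d ≡ 6 × 4 ≤ t)
  size-cases d t d≤6 t≤d 40≤ with 5 ≤? d | 6 ≤? d
  ... | no ¬5≤d | _ = ⊥-elim (from-no (40 ≤? 32) (≤-trans 40≤
          (+-mono-≤ (*-monoʳ-≤ 5 d≤4) (*-monoʳ-≤ 3 (≤-trans t≤d d≤4)))))
    where d≤4 = s≤s⁻¹ (≰⇒> ¬5≤d)
  ... | yes 5≤d | no ¬6≤d with refl ← ≤-antisym (s≤s⁻¹ (≰⇒> ¬6≤d)) 5≤d =
          inj₁ (refl , *-cancelˡ-≤ 3 (+-cancelˡ-≤ 25 15 (3 * t) 40≤))
  ... | yes _ | yes 6≤d with refl ← ≤-antisym d≤6 6≤d =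
          inj₂ (refl , ≮⇒≥ λ t<4 → from-no (40 ≤? 39) (≤-trans 40≤ (+-monoʳ-≤ 30 (*-monoʳ-≤ 3 (s≤s⁻¹ t<4)))))

-- Cliques, and tight and loose edges

module Claw-free-without-K₅ {n} (G : Graph n) (claw-free : ClawFree G) (no-K₅ : ¬ HasClique G 5) where

  infix 4 _~_ _~?_

  _~_ : Fin n → Fin n → Set
  _~_ = Adj G

  _~?_ : ∀ u v → Dec (u ~ v)
  u ~? v = T? (adj G u v)

  private variable
    a p q s t u v w x y z : Fin n
    X : Pred (Fin n) 0ℓ

  ~-sym : u ~ v → v ~ u
  ~-sym {u} {v} = subst T (Graph.sym G u v)

  ~⇒≢ : u ~ v → u ≢ v
  ~⇒≢ {u} u~u refl = subst T (irrefl G u) u~u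

  claw : w ~ x → w ~ y → w ~ z → x ≢ y → x ≢ z → y ≢ z → x ~ y ⊎ x ~ z ⊎ y ~ z
  claw {w} {x} {y} {z} wx wy wz x≢y x≢z y≢z with x ~? y | x ~? z | y ~? z
  ... | yes xy | _      | _      = inj₁ xy
  ... | no _   | yes xz | _      = inj₂ (inj₁ xz)
  ... | no _   | no _   | yes yz = inj₂ (inj₂ yz)
  ... | no ¬xy | no ¬xz | no ¬yz =
    ⊥-elim (claw-free (w , x , y , z , wx , wy , wz , x≢y , x≢z , y≢z , ¬xy , ¬xz , ¬yz))

  Clique : Pred (Fin n) 0ℓ → Set
  Clique X = ∀ x y → X x → X y → x ≢ y → x ~ y

  clique≤4 : (X? : Decidable X) → Clique X → cnt X? ≤ 4
  clique≤4 X? cl = ≮⇒≥ λ lt → let f , inj , ok = pick X? lt in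
    no-K₅ (f , inj , λ i j i≢j → cl (f i) (f j) (ok i) (ok j) (i≢j ∘ inj))

  module _ (v : Fin n) (X? : Decidable X) (X⊆ : ∀ x → X x → v ~ x) where

    cone? : Decidable (λ x → x ≡ v ⊎ X x)
    cone? x = (x ≟ v) ⊎-dec X? x

    cnt-cone : suc (cnt X?) ≤ cnt cone?
    cnt-cone = ≤-trans (+-monoˡ-≤ _ (cnt≥1 (_≟ v) v refl))
      (cnt-disjoint cone? (_≟ v) X? (λ _ → inj₁) (λ _ → inj₂) (λ { _ refl vx → ~⇒≢ (X⊆ v vx) refl }))

    cone-clique : Clique X → Clique (λ x → x ≡ v ⊎ X x)
    cone-clique cl x y (inj₁ refl) (inj₁ refl) x≢y = contradiction refl x≢y
    cone-clique cl x y (inj₁ refl) (inj₂ Xy)   _   = X⊆ y Xy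
    cone-clique cl x y (inj₂ Xx)   (inj₁ refl) _   = ~-sym (X⊆ x Xx)
    cone-clique cl x y (inj₂ Xx)   (inj₂ Xy)       = cl x y Xx Xy

  -- The cone over `X` with apex `v` is again a clique and has one vertex more.
  clique≤3 : (X? : Decidable X) → Clique X → (∀ x → X x → v ~ x) → cnt X? ≤ 3
  clique≤3 {v = v} X? cl X⊆ = s≤s⁻¹
    (≤-trans (cnt-cone v X? X⊆) (clique≤4 (cone? v X? X⊆) (cone-clique v X? X⊆ cl)))

  clique≤2 : v ~ w → (X? : Decidable X) → Clique X → (∀ x → X x → v ~ x) → (∀ x → X x → w ~ x) → cnt X? ≤ 2
  clique≤2 {v} {w} vw X? cl X⊆v X⊆w = s≤s⁻¹
    (≤-trans (cnt-cone w X? X⊆w) (clique≤3 {v = v} (cone? w X? X⊆w) (cone-clique w X? X⊆w cl)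
      (λ { _ (inj₁ refl) → vw ; x (inj₂ Xx) → X⊆v x Xx })))

  Common : Fin n → Fin n → Pred (Fin n) 0ℓ
  Common v w x = v ~ x × w ~ x

  common? : ∀ v w → Decidable (Common v w)
  common? v w x = (v ~? x) ×-dec (w ~? x)

  Tight : Fin n → Fin n → Set
  Tight v w = Clique (Common v w)

  -- The negation of `Tight` in witnessed form: it is decided by search, and this decides `Tight`.
  Loose : Fin n → Fin n → Set
  Loose v w = Σ (Fin n) λ x → Σ (Fin n) λ y → Common v w x × Common v w y × x ≢ y × ¬ x ~ y

  loose? : ∀ v w → Dec (Loose v w)
  loose? v w = any? λ x → any? λ y → common? v w x ×-dec common? v w y ×-dec ¬? (x ≟ y) ×-dec ¬? (x ~? y)

  loose⇒¬tight : Loose v w → ¬ Tight v w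
  loose⇒¬tight (x , y , cx , cy , x≢y , ¬xy) tight = ¬xy (tight x y cx cy x≢y)

  ¬loose⇒tight : ¬ Loose v w → Tight v w
  ¬loose⇒tight ¬l x y cx cy x≢y = decidable-stable (x ~? y) λ ¬xy → ¬l (x , y , cx , cy , x≢y , ¬xy)

  tight? : ∀ v w → Dec (Tight v w)
  tight? v w with loose? v w
  ... | yes l = no (loose⇒¬tight l)
  ... | no ¬l = yes (¬loose⇒tight ¬l)

  ¬tight⇒loose : ¬ Tight v w → Loose v w
  ¬tight⇒loose {v} {w} ¬t = decidable-stable (loose? v w) (¬t ∘ ¬loose⇒tight)

  tight-sym : Tight v w → Tight w v
  tight-sym t x y cx cy = t x y (swap cx) (swap cy)

  tight⇒common≤2 : v ~ w → Tight v w → cnt (common? v w) ≤ 2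
  tight⇒common≤2 {v} {w} vw t = clique≤2 vw (common? v w) t (λ _ → proj₁) (λ _ → proj₂)

  degree : Fin n → ℕ
  degree v = cnt (v ~?_)

  TightNbr LooseNbr : Fin n → Pred (Fin n) 0ℓ
  TightNbr v w = v ~ w × Tight v w
  LooseNbr v w = v ~ w × ¬ Tight v w

  tightNbr? : ∀ v → Decidable (TightNbr v)
  tightNbr? v w = (v ~? w) ×-dec tight? v w

  looseNbr? : ∀ v → Decidable (LooseNbr v)
  looseNbr? v w = (v ~? w) ×-dec ¬? (tight? v w)

  tight+loose : ∀ v → cnt (tightNbr? v) + cnt (looseNbr? v) ≤ degree v
  tight+loose v = cnt-disjoint (v ~?_) (tightNbr? v) (looseNbr? v)
    (λ _ → proj₁) (λ _ → proj₁) (λ _ (_ , t) (_ , ¬t) → ¬t t)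

  -- The second neighbourhood

  Second : Fin n → Pred (Fin n) 0ℓ
  Second v s = v ≢ s × ¬ v ~ s × Σ (Fin n) λ w → v ~ w × w ~ s

  second? : ∀ v → Decidable (Second v)
  second? v s = ¬? (v ≟ s) ×-dec ¬? (v ~? s) ×-dec any? λ w → (v ~? w) ×-dec (w ~? s)

  eqFin-refl : ∀ {k} (i : Fin k) → T (eqFin i i)
  eqFin-refl zero    = _
  eqFin-refl (suc i) = eqFin-refl i

  anyFin⇒∃ : ∀ {k} (f : Fin k → Bool) → T (anyFin f) → Σ (Fin k) λ i → T (f i)
  anyFin⇒∃ {suc k} f h with Equivalence.to (T-∨ {f zero}) h
  ... | inj₁ f0 = zero , f0
  ... | inj₂ fs with i , fi ← anyFin⇒∃ (f ∘ suc) fs = suc i , fi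

  sqAdj⇒ : ∀ v s → T (sqAdj G v s) → v ~ s ⊎ Second v s
  sqAdj⇒ v s h with v ~? s | Equivalence.to (T-∧ {not (eqFin v s)}) h
  ... | yes vs | _ = inj₁ vs
  ... | no ¬vs | v≠s , h′ with Equivalence.to (T-∨ {adj G v s}) h′
  ... | inj₁ vs = inj₁ vs
  ... | inj₂ c with w , vws ← anyFin⇒∃ _ c =
    inj₂ ((λ { refl → T-not (eqFin v v) (eqFin-refl v) v≠s }) , ¬vs , w , Equivalence.to (T-∧ {adj G v w}) vws)
    where
    T-not : ∀ b → T b → T (not b) → ⊥
    T-not true _ ()

  degSq≤ : ∀ v → degSq G v ≤ degree v + cnt (second? v)
  degSq≤ v = cnt-cover (λ s → T? (sqAdj G v s)) (v ~?_) (second? v) (sqAdj⇒ v)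

  -- For fixed `v`, the incidence relation between N(v) and the second neighbourhood over which the
  -- double counts run.
  Out : Fin n → Fin n → Pred (Fin n) 0ℓ
  Out v w s = v ~ w × w ~ s × v ≢ s × ¬ v ~ s

  out? : ∀ v w → Decidable (Out v w)
  out? v w s = (v ~? w) ×-dec (w ~? s) ×-dec ¬? (v ≟ s) ×-dec ¬? (v ~? s)

  -- Two nonadjacent ones would form a claw at `w` together with `v`; and `w` is adjacent to the
  -- whole clique.
  out≤3 : ∀ v w → cnt (out? v w) ≤ 3
  out≤3 v w = clique≤3 {v = w} (out? v w) clique (λ _ → proj₁ ∘ proj₂)
    where
    clique : Clique (Out v w)
    clique s t (vw , ws , v≢s , ¬vs) (_ , wt , v≢t , ¬vt) s≢t with claw (~-sym vw) ws wt v≢s v≢t s≢t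
    ... | inj₁ vs        = contradiction vs ¬vs
    ... | inj₂ (inj₁ vt) = contradiction vt ¬vt
    ... | inj₂ (inj₂ st) = st

  -- A second neighbour of v seen through a loose neighbour is seen through
  -- another neighbour as well, so only tight neighbours count twice.
  second-bound : ∀ v → 2 * cnt (second? v) ≤ 3 * degree v + 3 * cnt (tightNbr? v)
  second-bound v = ≤-trans (sum≥ 2 (second? v) _ seen)
    (≤-trans (≤-reflexive (∑-distrib-+ {n} (λ s → cnt (λ w → out? v w s)) (λ s → cnt (λ w → tightOut? w s))))
      (+-mono-≤ (sum-cnt≤ 3 (out? v) (v ~?_) (λ _ _ → proj₁) (λ w _ → out≤3 v w))
                (sum-cnt≤ 3 tightOut? (tightNbr? v) (λ _ _ ((vw , _) , t) → vw , t)
                   (λ w _ → ≤-trans (cnt-mono (tightOut? w) (out? v w) (λ _ → proj₁)) (out≤3 v w)))))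
    where
    tightOut? : ∀ w → Decidable (λ s → Out v w s × Tight v w)
    tightOut? w s = out? v w s ×-dec tight? v w

    seen : ∀ s → Second v s → 2 ≤ cnt (λ w → out? v w s) + cnt (λ w → tightOut? w s)
    seen s (v≢s , ¬vs , w , vw , ws) with tight? v w
    ... | yes t = +-mono-≤ (cnt≥1 (λ w → out? v w s) w o) (cnt≥1 (λ w → tightOut? w s) w (o , t))
      where o = vw , ws , v≢s , ¬vs
    -- The nonadjacent `x` and `y` are common neighbours of `v` and `w`. As `s`, `x`, `y` form no
    -- claw at `w`, one of `x` and `y` sees `s` too.
    ... | no ¬t with x , y , (vx , wx) , (vy , wy) , x≢y , ¬xy ← ¬tight⇒loose ¬t
      with claw ws wx wy (λ { refl → ¬vs vx }) (λ { refl → ¬vs vy }) x≢y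
    ... | inj₁ sx        = ≤-trans (cnt≥2 (λ w → out? v w s) (~⇒≢ wx)
                             (vw , ws , v≢s , ¬vs) (vx , ~-sym sx , v≢s , ¬vs)) (m≤m+n _ _)
    ... | inj₂ (inj₁ sy) = ≤-trans (cnt≥2 (λ w → out? v w s) (~⇒≢ wy)
                             (vw , ws , v≢s , ¬vs) (vy , ~-sym sy , v≢s , ¬vs)) (m≤m+n _ _)
    ... | inj₂ (inj₂ xy) = contradiction xy ¬xy

  -- Bounds on the degree

  non-nbrs≤3 : v ~ w → cnt (λ z → (v ~? z) ×-dec ¬? (z ≟ w) ×-dec ¬? (w ~? z)) ≤ 3
  non-nbrs≤3 {v} {w} vw = clique≤3 {v = v} (λ z → (v ~? z) ×-dec ¬? (z ≟ w) ×-dec ¬? (w ~? z)) clique (λ _ → proj₁)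
    where
    clique : Clique (λ z → v ~ z × z ≢ w × ¬ w ~ z)
    clique x y (vx , x≢w , ¬wx) (vy , y≢w , ¬wy) x≢y with claw vw vx vy (x≢w ∘ sym) (y≢w ∘ sym) x≢y
    ... | inj₁ wx        = contradiction wx ¬wx
    ... | inj₂ (inj₁ wy) = contradiction wy ¬wy
    ... | inj₂ (inj₂ xy) = xy

  -- The 4 counts `w` and the nonneighbours of `w` in N(v), of which there are at most three: for
  -- lack of a claw at `v` they form a clique, and `v` extends it.
  degree≤4+common : v ~ w → degree v ≤ 4 + cnt (common? v w)
  degree≤4+common {v} {w} vw = ≤-trans
    (cnt-cover (v ~?_) far? (common? v w) split)
    (+-monoˡ-≤ _ (≤-trans (cnt-cover far? (_≟ w) rest? (λ _ → id)) (+-mono-≤ (cnt-≟ w) (non-nbrs≤3 vw))))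
    where
    rest? = λ z → (v ~? z) ×-dec ¬? (z ≟ w) ×-dec ¬? (w ~? z)
    far? = λ z → (z ≟ w) ⊎-dec rest? z
    split : ∀ z → v ~ z → (z ≡ w ⊎ v ~ z × z ≢ w × ¬ w ~ z) ⊎ Common v w z
    split z vz with z ≟ w | w ~? z
    ... | yes z≡w | _      = inj₁ (inj₁ z≡w)
    ... | no _    | yes wz = inj₂ (vz , wz)
    ... | no z≢w  | no ¬wz = inj₁ (inj₂ (vz , z≢w , ¬wz))

  tight⇒degree≤6 : v ~ w → Tight v w → degree v ≤ 6
  tight⇒degree≤6 vw t = ≤-trans (degree≤4+common vw) (+-monoʳ-≤ 4 (tight⇒common≤2 vw t))

  triangle-in-common : v ~ w → Common v w x → Common v w y → Common v w z → x ~ y → x ~ z → ¬ y ~ z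
  triangle-in-common {v} {w} {x} {y} {z} vw cx cy cz xy xz yz =
    <⇒≱ (cnt≥3 xyz? (~⇒≢ xy) (~⇒≢ xz) (~⇒≢ yz) (inj₁ refl) (inj₂ (inj₁ refl)) (inj₂ (inj₂ refl)))
        (clique≤2 vw xyz? clique
          (λ { _ (inj₁ refl) → proj₁ cx ; _ (inj₂ (inj₁ refl)) → proj₁ cy ; _ (inj₂ (inj₂ refl)) → proj₁ cz })
          (λ { _ (inj₁ refl) → proj₂ cx ; _ (inj₂ (inj₁ refl)) → proj₂ cy ; _ (inj₂ (inj₂ refl)) → proj₂ cz }))
    where
    xyz? = λ i → (i ≟ x) ⊎-dec (i ≟ y) ⊎-dec (i ≟ z)
    clique : Clique (λ i → i ≡ x ⊎ i ≡ y ⊎ i ≡ z)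
    clique _ _ (inj₁ refl)        (inj₁ refl)        ne = contradiction refl ne
    clique _ _ (inj₁ refl)        (inj₂ (inj₁ refl)) _  = xy
    clique _ _ (inj₁ refl)        (inj₂ (inj₂ refl)) _  = xz
    clique _ _ (inj₂ (inj₁ refl)) (inj₁ refl)        _  = ~-sym xy
    clique _ _ (inj₂ (inj₁ refl)) (inj₂ (inj₁ refl)) ne = contradiction refl ne
    clique _ _ (inj₂ (inj₁ refl)) (inj₂ (inj₂ refl)) _  = yz
    clique _ _ (inj₂ (inj₂ refl)) (inj₁ refl)        _  = ~-sym xz
    clique _ _ (inj₂ (inj₂ refl)) (inj₂ (inj₁ refl)) _  = ~-sym yz
    clique _ _ (inj₂ (inj₂ refl)) (inj₂ (inj₂ refl)) ne = contradiction refl ne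

  -- The argument for R(3,3) = 6: in the common neighbourhood a triangle would give K₅, and three
  -- independent vertices a claw at `v`. For a fixed `z`, count `z` itself, at most two
  -- nonneighbours and at most two neighbours of `z`.
  common≤5 : v ~ w → cnt (common? v w) ≤ 5
  common≤5 {v} {w} vw = ≮⇒≥ λ lt → <⇒≱ lt (bound (pick₁ (common? v w) (≤-trans (s≤s z≤n) lt)))
    where
    bound : ∃ (Common v w) → cnt (common? v w) ≤ 5
    bound (z , vz , wz) = ≤-trans (cnt-cover (common? v w) (λ x → (x ≟ z) ⊎-dec far? x) near? split)
      (+-mono-≤ {_} {3} {_} {2} (≤-trans (cnt-cover (λ x → (x ≟ z) ⊎-dec far? x) (_≟ z) far? (λ _ → id)) (+-mono-≤ (cnt-≟ z) far≤2)) near≤2)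
      where
      near? = λ x → common? v w x ×-dec (z ~? x)
      far?  = λ x → common? v w x ×-dec ¬? (x ≟ z) ×-dec ¬? (z ~? x)
      split : ∀ x → Common v w x → (x ≡ z ⊎ Common v w x × x ≢ z × ¬ z ~ x) ⊎ (Common v w x × z ~ x)
      split x cx with x ≟ z | z ~? x
      ... | yes x≡z | _      = inj₁ (inj₁ x≡z)
      ... | no _    | yes zx = inj₂ (cx , zx)
      ... | no x≢z  | no ¬zx = inj₁ (inj₂ (cx , x≢z , ¬zx))
      far≤2 : cnt far? ≤ 2
      far≤2 = clique≤2 vw far? clique (λ _ → proj₁ ∘ proj₁) (λ _ → proj₂ ∘ proj₁)
        where
        clique : Clique (λ x → Common v w x × x ≢ z × ¬ z ~ x)
        clique x y ((vx , _) , x≢z , ¬zx) ((vy , _) , y≢z , ¬zy) x≢y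
          with claw vz vx vy (x≢z ∘ sym) (y≢z ∘ sym) x≢y
        ... | inj₁ zx        = contradiction zx ¬zx
        ... | inj₂ (inj₁ zy) = contradiction zy ¬zy
        ... | inj₂ (inj₂ xy) = xy
      near≤2 : cnt near? ≤ 2
      near≤2 = ≮⇒≥ λ lt → let f , inj , ok = pick near? lt
                              v~_  = λ i → proj₁ (proj₁ (ok i))
                              dist = λ i j (i≢j : i ≢ j) → i≢j ∘ inj
                              non  = λ i j → triangle-in-common vw (vz , wz) (proj₁ (ok i)) (proj₁ (ok j))
                                               (proj₂ (ok i)) (proj₂ (ok j))
        in [ non 0F 1F , [ non 0F 2F , non 1F 2F ]′ ]′
             (claw (v~ 0F) (v~ 1F) (v~ 2F) (dist 0F 1F λ ()) (dist 0F 2F λ ()) (dist 1F 2F λ ()))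

  degree≤9 : ∀ v → degree v ≤ 9
  degree≤9 v = ≮⇒≥ λ lt → let w , vw = pick₁ (v ~?_) (≤-trans (s≤s z≤n) lt) in
    <⇒≱ lt (≤-trans (degree≤4+common vw) (+-monoʳ-≤ 4 (common≤5 vw)))

  -- If `s` is seen through `w`, then `v` and `w` have at least four common neighbours. Those
  -- missing `s` form a clique, for lack of a claw at `w`, so they number at most two; at least two
  -- others see `s`, and so does `w`.
  seen-thrice : 8 ≤ degree v → ∀ s → Second v s → 3 ≤ cnt (λ w → out? v w s)
  seen-thrice {v} 8≤d s (v≢s , ¬vs , w , vw , ws) =
    let x , y , x≢y , ((vx , wx) , sx) , ((vy , wy) , sy) = pick₂ near? 2≤near in
    cnt≥3 (λ w → out? v w s) (~⇒≢ wx) (~⇒≢ wy) x≢y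
      (vw , ws , v≢s , ¬vs) (vx , ~-sym sx , v≢s , ¬vs) (vy , ~-sym sy , v≢s , ¬vs)
    where
    near? = λ x → common? v w x ×-dec (s ~? x)
    far?  = λ x → common? v w x ×-dec ¬? (s ~? x)
    far≤2 : cnt far? ≤ 2
    far≤2 = clique≤2 vw far? clique (λ _ → proj₁ ∘ proj₁) (λ _ → proj₂ ∘ proj₁)
      where
      clique : Clique (λ x → Common v w x × ¬ s ~ x)
      clique x y ((vx , wx) , ¬sx) ((vy , wy) , ¬sy) x≢y
        with claw ws wx wy (λ { refl → ¬vs vx }) (λ { refl → ¬vs vy }) x≢y
      ... | inj₁ sx        = contradiction sx ¬sx
      ... | inj₂ (inj₁ sy) = contradiction sy ¬sy
      ... | inj₂ (inj₂ xy) = xy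
    split : ∀ x → Common v w x → (Common v w x × ¬ s ~ x) ⊎ (Common v w x × s ~ x)
    split x cx with s ~? x
    ... | yes sx = inj₂ (cx , sx)
    ... | no ¬sx = inj₁ (cx , ¬sx)
    2≤near : 2 ≤ cnt near?
    2≤near = +-cancelˡ-≤ 6 _ _ (≤-trans 8≤d (≤-trans (degree≤4+common vw)
      (+-monoʳ-≤ 4 (≤-trans (cnt-cover (common? v w) far? near? split) (+-monoˡ-≤ _ far≤2)))))

  second≤degree : 8 ≤ degree v → cnt (second? v) ≤ degree v
  second≤degree {v} 8≤d = *-cancelˡ-≤ 3 (double-count 3 3 (out? v) (second? v) (v ~?_)
    (seen-thrice 8≤d) (λ _ _ → proj₁) (λ w _ → out≤3 v w))

  -- Consequences of a large square degree

  degSq-bound : ∀ k → k ≤ degSq G v → 2 * k ≤ 5 * degree v + 3 * cnt (tightNbr? v)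
  degSq-bound {v} k k≤ = begin
    2 * k                     ≤⟨ *-monoʳ-≤ 2 (≤-trans k≤ (degSq≤ v)) ⟩
    2 * (d + cnt (second? v)) ≡⟨ *-distribˡ-+ 2 d _ ⟩
    2 * d + 2 * cnt (second? v) ≤⟨ +-monoʳ-≤ (2 * d) (second-bound v) ⟩
    2 * d + (3 * d + 3 * τ)   ≡⟨ rearrange d τ ⟩
    5 * d + 3 * τ             ∎
    where
    open ≤-Reasoning
    d = degree v
    τ = cnt (tightNbr? v)
    rearrange : ∀ d t → 2 * d + (3 * d + 3 * t) ≡ 5 * d + 3 * t
    rearrange = solve-∀

  -- From degree 8 on, the square degree is at most 9 + 9. In degree 7 no edge is tight, as a tight
  -- edge allows degree at most 6, and `degSq-bound` would give 40 ≤ 35.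
  20≤degSq⇒degree≤6 : 20 ≤ degSq G v → degree v ≤ 6
  20≤degSq⇒degree≤6 {v} 20≤ = ≮⇒≥ λ 6<d → absurd 6<d (8 ≤? degree v)
    where
    absurd : 6 < degree v → Dec (8 ≤ degree v) → ⊥
    absurd _ (yes 8≤d) = from-no (20 ≤? 18) (≤-trans 20≤ (≤-trans (degSq≤ v)
      (+-mono-≤ (degree≤9 v) (≤-trans (second≤degree 8≤d) (degree≤9 v)))))
    absurd 6<d (no ¬8≤d) = from-no (40 ≤? 35) (≤-trans (degSq-bound 20 20≤) bound)
      where
      no-tight : cnt (tightNbr? v) ≤ 0
      no-tight = ≮⇒≥ λ lt → let w , vw , t = pick₁ (tightNbr? v) lt in <⇒≱ 6<d (tight⇒degree≤6 vw t)
      bound : 5 * degree v + 3 * cnt (tightNbr? v) ≤ 35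
      bound = +-mono-≤ (*-monoʳ-≤ 5 (s≤s⁻¹ (≰⇒> ¬8≤d))) (*-monoʳ-≤ 3 no-tight)

  tight≤degree : ∀ v → cnt (tightNbr? v) ≤ degree v
  tight≤degree v = ≤-trans (m≤m+n _ _) (tight+loose v)

  20≤degSq⇒sizes : 20 ≤ degSq G v → (degree v ≡ 5 × 5 ≤ cnt (tightNbr? v)) ⊎ (degree v ≡ 6 × 4 ≤ cnt (tightNbr? v))
  20≤degSq⇒sizes {v} 20≤ =
    size-cases _ _ (20≤degSq⇒degree≤6 20≤) (tight≤degree v) (degSq-bound 20 20≤)

  21≤degSq⇒degree≢5 : 21 ≤ degSq G v → degree v ≢ 5
  21≤degSq⇒degree≢5 {v} 21≤ d≡5 = from-no (42 ≤? 40) (≤-trans (degSq-bound 21 21≤)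
    (+-mono-≤ (*-monoʳ-≤ 5 (≤-reflexive d≡5)) (*-monoʳ-≤ 3 (≤-trans (tight≤degree v) (≤-reflexive d≡5)))))

  -- At most two loose edges at `v`, phrased so that three distinct loose neighbours give a
  -- contradiction at once.
  Few : Fin n → Set
  Few v = ∀ {x y z} → x ≢ y → x ≢ z → y ≢ z → LooseNbr v x → LooseNbr v y → ¬ LooseNbr v z

  loose≤2⇒few : cnt (looseNbr? v) ≤ 2 → Few v
  loose≤2⇒few {v} ≤2 x≢y x≢z y≢z lx ly lz = <⇒≱ (cnt≥3 (looseNbr? v) x≢y x≢z y≢z lx ly lz) ≤2

  -- Neighbourhoods that split into two cliques

  Near : Fin n → Fin n → Set
  Near p z = z ≡ p ⊎ p ~ z

  near? : ∀ p → Decidable (Near p)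
  near? p z = (z ≟ p) ⊎-dec (p ~? z)

  near-sym : Near p z → Near z p
  near-sym (inj₁ refl) = inj₁ refl
  near-sym (inj₂ pz)   = inj₂ (~-sym pz)

  -- In a claw-free graph these conditions partition N(v) into two cliques, the parts N(v) ∩ N[p]
  -- and N(v) ∩ N[q]: see `cover`, `sep` and `part-clique`.
  record Base (v p q : Fin n) : Set where
    field
      vp   : v ~ p
      vq   : v ~ q
      p≢q  : p ≢ q
      ¬pq  : ¬ p ~ q
      sep~ : ∀ {z} → v ~ z → p ~ z → ¬ q ~ z

    sep : v ~ z → Near p z → ¬ Near q z
    sep vz (inj₁ refl) (inj₁ z≡q) = p≢q z≡q
    sep vz (inj₁ refl) (inj₂ qp)  = ¬pq (~-sym qp)
    sep vz (inj₂ pq)   (inj₁ refl) = ¬pq pq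
    sep vz (inj₂ pz)   (inj₂ qz)  = sep~ vz pz qz

    cover : v ~ z → Near p z ⊎ Near q z
    cover {z} vz with z ≟ p | z ≟ q
    ... | yes z≡p | _       = inj₁ (inj₁ z≡p)
    ... | no _    | yes z≡q = inj₂ (inj₁ z≡q)
    ... | no z≢p  | no z≢q with claw vp vq vz p≢q (z≢p ∘ sym) (z≢q ∘ sym)
    ... | inj₁ pq        = contradiction pq ¬pq
    ... | inj₂ (inj₁ pz) = inj₁ (inj₂ pz)
    ... | inj₂ (inj₂ qz) = inj₂ (inj₂ qz)

    part-clique : v ~ x → v ~ y → Near p x → Near p y → x ≢ y → x ~ y
    part-clique {x} {y} vx vy px py x≢y
      with claw vx vy vq x≢y (λ { refl → sep vx px (inj₁ refl) }) (λ { refl → sep vy py (inj₁ refl) })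
    ... | inj₁ xy        = xy
    ... | inj₂ (inj₁ xq) = ⊥-elim (sep vx px (inj₂ (~-sym xq)))
    ... | inj₂ (inj₂ yq) = ⊥-elim (sep vy py (inj₂ (~-sym yq)))

    tight-p : Tight v p
    tight-p x y (vx , px) (vy , py) = part-clique vx vy (inj₂ px) (inj₂ py)

    -- If `x` is `p`, then `y` would lie in both parts. Otherwise `p` and `y` are common neighbours
    -- of `v` and `x`, and tightness would make them adjacent, with the same outcome.
    cross⇒loose : v ~ x → v ~ y → Near p x → Near q y → x ~ y → ¬ Tight v x
    cross⇒loose vx vy (inj₁ refl) qy xy t = sep vy (inj₂ xy) qy
    cross⇒loose vx vy (inj₂ px)   qy xy t =
      sep vy (inj₂ (t _ _ (vp , ~-sym px) (vy , xy) (λ { refl → sep vp (inj₁ refl) qy }))) qy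

  base-sym : Base v p q → Base v q p
  base-sym B = record
    { vp = vq ; vq = vp ; p≢q = p≢q ∘ sym ; ¬pq = ¬pq ∘ ~-sym ; sep~ = λ vz qz pz → sep~ vz pz qz }
    where open Base B

  Two : Fin n → Fin n → Set
  Two v p = Σ (Fin n) λ x → Σ (Fin n) λ y → x ≢ y × Common v p x × Common v p y

  two-sym : Two v p → Two p v
  two-sym (x , y , x≢y , cx , cy) = x , y , x≢y , swap cx , swap cy

  two-other : Two v p → ∀ u → Σ (Fin n) λ x → x ≢ u × Common v p x
  two-other (x , y , x≢y , cx , cy) u with x ≟ u
  ... | no x≢u   = x , x≢u , cx
  ... | yes refl = y , x≢y ∘ sym , cy

  -- The part of `p` is a clique, so a vertex `z` of it other than `p` is adjacent to `p` and to a
  -- witness of `Two v p` that differs from `z`.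
  two-part : Base v p q → Two v p → v ~ z → Near p z → Two v z
  two-part B two vz (inj₁ refl) = two
  two-part {z = z} B two vz (inj₂ pz) with x , x≢z , vx , px ← two-other two z =
    _ , x , ~⇒≢ px , (vp , ~-sym pz) , (vx , part-clique vz vx (inj₂ pz) (inj₂ px) (x≢z ∘ sym))
    where open Base B

  -- Constructing bases from tight neighbours

  part? : ∀ v a → Decidable (λ z → v ~ z × Near a z)
  part? v a z = (v ~? z) ×-dec near? a z

  tight-part≤3 : v ~ a → Tight v a → cnt (part? v a) ≤ 3
  tight-part≤3 {v} {a} va t = clique≤3 {v = v} (part? v a) clique (λ _ → proj₁)
    where
    clique : Clique (λ z → v ~ z × Near a z)
    clique x y (_  , inj₁ refl) (_  , inj₁ refl) x≢y = contradiction refl x≢y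
    clique x y (_  , inj₁ refl) (_  , inj₂ ay)   _   = ay
    clique x y (_  , inj₂ ax)   (_  , inj₁ refl) _   = ~-sym ax
    clique x y (vx , inj₂ ax)   (vy , inj₂ ay)   x≢y = t x y (vx , ax) (vy , ay) x≢y

  -- The part of a tight neighbour `p` has at most three vertices, so it cannot contain all of `X`.
  pick-far : (X? : Decidable X) → (∀ x → X x → v ~ x) → 4 ≤ cnt X? → v ~ p → Tight v p →
             Σ (Fin n) λ q → X q × ¬ Near p q
  pick-far {X} {v} {p} X? X⊆ 4≤ vp tp = pick₁ far? (+-cancelˡ-≤ 3 _ _
    (≤-trans 4≤ (≤-trans (cnt-cover X? (part? v p) far? split) (+-monoˡ-≤ _ (tight-part≤3 vp tp)))))
    where
    far? = λ z → X? z ×-dec ¬? (near? p z)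
    split : ∀ z → X z → (v ~ z × Near p z) ⊎ (X z × ¬ Near p z)
    split z Xz with near? p z
    ... | yes pz = inj₁ (X⊆ z Xz , pz)
    ... | no ¬pz = inj₂ (Xz , ¬pz)

  AllTight : Fin n → Set
  AllTight v = ∀ z → v ~ z → Tight v z

  -- Any `q` outside the part of `p` will do: a vertex `z` of N(v) adjacent to both would make `p`
  -- and `q` adjacent, because the edge `v z` is tight.
  all-tight⇒base : AllTight v → 4 ≤ degree v → Σ (Fin n) λ p → Σ (Fin n) λ q → Base v p q
  all-tight⇒base {v} tight 4≤d with p , vp ← pick₁ (v ~?_) (≤-trans (s≤s z≤n) 4≤d)
    with q , vq , ¬near ← pick-far (v ~?_) (λ _ → id) 4≤d vp (tight p vp)
    = p , q , record
      { vp = vp ; vq = vq ; p≢q = λ { refl → ¬near (inj₁ refl) } ; ¬pq = ¬near ∘ inj₂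
      ; sep~ = λ vz pz qz → ¬near (inj₂ (tight _ vz p q (vp , ~-sym pz) (vq , ~-sym qz)
                 (λ { refl → ¬near (inj₁ refl) }))) }

  six⇒two : degree v ≡ 6 → v ~ a → Two v a
  six⇒two {v} {a} d≡6 va = pick₂ (common? v a)
    (+-cancelˡ-≤ 4 _ _ (≤-trans (≤-reflexive (sym d≡6)) (degree≤4+common va)))

  -- Four tight neighbours do not fit into the part of `p`, so `q` can be chosen tight as well, and
  -- both parts have at most three vertices.
  six⇒base : degree v ≡ 6 → 4 ≤ cnt (tightNbr? v) → Σ (Fin n) λ p → Σ (Fin n) λ q → Base v p q
  six⇒base {v} d≡6 4≤τ with p , vp , tp ← pick₁ (tightNbr? v) (≤-trans (s≤s z≤n) 4≤τ)
    with q , (vq , tq) , ¬near ← pick-far (tightNbr? v) (λ _ → proj₁) 4≤τ vp tp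
    = p , q , record
      { vp = vp ; vq = vq ; p≢q = p≢q ; ¬pq = ¬near ∘ inj₂ ; sep~ = disjoint }
    where
    p≢q : p ≢ q
    p≢q refl = ¬near (inj₁ refl)
    -- The parts of p and q have at most three elements each and cover the six neighbours.
    disjoint : v ~ z → p ~ z → ¬ q ~ z
    disjoint {z} vz pz qz = from-no (6 ≤? 5) (≤-trans (≤-reflexive (sym d≡6))
      (≤-trans (cnt-cover (v ~?_) (without? z (part? v p)) (part? v q) covers)
        (+-mono-≤ (s≤s⁻¹ (≤-trans (cnt-remove (part? v p) z (vz , inj₂ pz)) (tight-part≤3 vp tp)))
                  (tight-part≤3 vq tq))))
      where
      covers : ∀ x → v ~ x → Without z (λ x → v ~ x × Near p x) x ⊎ (v ~ x × Near q x)
      covers x vx with near? q x | x ≟ p | p ~? x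
      ... | yes qx | _        | _      = inj₂ (vx , qx)
      ... | no ¬qx | yes refl | _      = inj₁ (~⇒≢ pz , vx , inj₁ refl)
      ... | no ¬qx | no _     | yes px = inj₁ ((λ { refl → ¬qx (inj₂ qz) }) , vx , inj₂ px)
      ... | no ¬qx | no x≢p   | no ¬px with claw vp vq vx p≢q (x≢p ∘ sym) (¬qx ∘ inj₁ ∘ sym)
      ...   | inj₁ pq        = contradiction (inj₂ pq) ¬near
      ...   | inj₂ (inj₁ px) = contradiction px ¬px
      ...   | inj₂ (inj₂ qx) = contradiction (inj₂ qx) ¬qx

  -- Frames: the local structure forced at every vertex when (ii) fails

  Frame : Fin n → Set
  Frame v = Σ (Fin n) λ p → Σ (Fin n) λ q → Base v p q ×
    (AllTight v ⊎ (Two v p × Two v q × (Few v ⊎ (21 ≤ degSq G p × 21 ≤ degSq G q))))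

  few : 20 ≤ degSq G v → Few v
  few {v} 20≤ = loose≤2⇒few ([ five , six ]′ (20≤degSq⇒sizes 20≤))
    where
    five : degree v ≡ 5 × 5 ≤ cnt (tightNbr? v) → cnt (looseNbr? v) ≤ 2
    five (d≡5 , 5≤τ) = ≤-trans (+-cancelˡ-≤ 5 _ 0
      (≤-trans (+-monoˡ-≤ _ 5≤τ) (≤-trans (tight+loose v) (≤-reflexive d≡5)))) z≤n
    six : degree v ≡ 6 × 4 ≤ cnt (tightNbr? v) → cnt (looseNbr? v) ≤ 2
    six (d≡6 , 4≤τ) = +-cancelˡ-≤ 4 _ 2
      (≤-trans (+-monoˡ-≤ _ 4≤τ) (≤-trans (tight+loose v) (≤-reflexive d≡6)))

  five⇒all-tight : degree v ≡ 5 → 5 ≤ cnt (tightNbr? v) → AllTight v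
  five⇒all-tight {v} d≡5 5≤τ z vz = decidable-stable (tight? v z) λ ¬t →
    from-no (6 ≤? 5) (≤-trans (+-mono-≤ 5≤τ (cnt≥1 (looseNbr? v) z (vz , ¬t)))
                              (≤-trans (tight+loose v) (≤-reflexive d≡5)))

  six⇒frame : degree v ≡ 6 → 4 ≤ cnt (tightNbr? v) →
              Σ (Fin n) λ p → Σ (Fin n) λ q → Base v p q × Two v p × Two v q
  six⇒frame d≡6 4≤τ = let p , q , B = six⇒base d≡6 4≤τ in
    p , q , B , six⇒two d≡6 (Base.vp B) , six⇒two d≡6 (Base.vq B)

  -- Degree five makes every edge tight, and degree six leaves at most two loose ones. The remaining
  -- alternative of `Frame` comes from `bad-pair⇒frame`.
  20≤degSq⇒frame : 20 ≤ degSq G v → Frame v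
  20≤degSq⇒frame {v} 20≤ = [ five , six ]′ (20≤degSq⇒sizes 20≤)
    where
    five : degree v ≡ 5 × 5 ≤ cnt (tightNbr? v) → Frame v
    five (d≡5 , 5≤τ) =
      let tight = five⇒all-tight d≡5 5≤τ
          p , q , B = all-tight⇒base tight (≤-trans (m≤n+m 4 1) (≤-reflexive (sym d≡5)))
      in p , q , B , inj₁ tight
    six : degree v ≡ 6 × 4 ≤ cnt (tightNbr? v) → Frame v
    six (d≡6 , 4≤τ) = let p , q , B , two-p , two-q = six⇒frame d≡6 4≤τ in
      p , q , B , inj₂ (two-p , two-q , inj₁ (few 20≤))

  -- Degree five being excluded, N(x) splits into two parts whose ends each have two common
  -- neighbours with `x`; this passes to `v` in whichever part it lies.
  21≤degSq⇒two : 21 ≤ degSq G x → x ~ v → Two v x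
  21≤degSq⇒two {x} {v} 21≤ xv =
    [ (λ (d≡5 , _) → contradiction d≡5 (21≤degSq⇒degree≢5 21≤)) , six ]′
      (20≤degSq⇒sizes (≤-trans (m≤n+m 20 1) 21≤))
    where
    six : degree x ≡ 6 × 4 ≤ cnt (tightNbr? x) → Two v x
    six (d≡6 , 4≤τ) = let p , q , B , two-p , two-q = six⇒frame d≡6 4≤τ in
      two-sym ([ two-part B two-p xv , two-part (base-sym B) two-q xv ]′ (Base.cover B xv))

  -- This is the failure of the clique condition in (ii). The vertices `x` and `y` are nonadjacent
  -- with no common neighbour except `v`, so they are themselves the ends of a base.
  bad-pair⇒frame : v ~ x → v ~ y → 21 ≤ degSq G x → 21 ≤ degSq G y → x ≢ y → ¬ sqDelAdj G v x y → Frame v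
  bad-pair⇒frame {v} {x} {y} vx vy 21≤x 21≤y x≢y ¬sq = x , y , base ,
    inj₂ (21≤degSq⇒two 21≤x (~-sym vx) , 21≤degSq⇒two 21≤y (~-sym vy) , inj₂ (21≤x , 21≤y))
    where
    base : Base v x y
    base = record { vp = vx ; vq = vy ; p≢q = x≢y ; ¬pq = λ xy → ¬sq (x≢y , inj₁ xy)
                  ; sep~ = λ vz xz yz → ¬sq (x≢y , inj₂ (_ , ~⇒≢ vz ∘ sym , xz , ~-sym yz)) }

  -- Consequences of a frame at every vertex

  module Framed (frame : ∀ v → Frame v) where

    -- If u is tight with s, an edge a–z leaving the part of u in N(s) is a cross edge.
    leaving-edge : s ~ u → Tight s u → s ~ a → a ~ u → s ~ z → a ~ z → z ≢ u → ¬ z ~ u → ¬ Tight s z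
    leaving-edge {s} {u} {a} {z} su t sa au sz az z≢u ¬zu with p , q , B , _ ← frame s
      = [ in-part B , in-part (base-sym B) ]′ (Base.cover B su)
      where
      in-part : ∀ {p q} → Base s p q → Near p u → ¬ Tight s z
      in-part {p} {q} B pu = Base.cross⇒loose (base-sym B) sz sa qz pa (~-sym az)
        where
        open Base B
        pa : Near p a
        pa = [ id , (λ qa → ⊥-elim (cross⇒loose su sa pu qa (~-sym au) t)) ]′ (cover sa)
        qz : Near q z
        qz = [ (λ pz → ⊥-elim (¬zu (part-clique sz su pz pu z≢u))) , id ]′ (cover sz)

    -- s would see the three loose neighbours a, q and r.
    no-loose-corner : a ~ v → Tight a v → Common a v u → Common a v x → u ≢ x →
      s ~ u → Tight s u → s ~ a → s ~ x → s ≢ v → ¬ s ~ v → ¬ 21 ≤ degSq G s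
    no-loose-corner {a} {v} {u} {x} {s} av tav (au , vu) (ax , vx) u≢x su tsu sa sx s≢v ¬sv 21≤ = finish (frame a)
      where
      loose-au : ¬ Tight a u
      loose-au t = ¬sv (t s v (~-sym sa , ~-sym su) (av , ~-sym vu) s≢v)
      loose-ax : ¬ Tight a x
      loose-ax t = ¬sv (t s v (~-sym sa , ~-sym sx) (av , ~-sym vx) s≢v)

      at-v : ∀ {q} → Base a v q → Two a q → ⊥
      at-v {q} B two with two-other two s
      ... | r , r≢s , ar , qr =
        few (≤-trans (m≤n+m 20 1) 21≤) (~⇒≢ vq) (~⇒≢ ar) (~⇒≢ qr)
          (sa , loose-sa)
          (sq , leaving-edge su tsu sa au sq vq (≢u ¬vq) ¬qu)
          (sr , leaving-edge su tsu sa au sr ar (≢u ¬vr) ¬ru)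
        where
        open Base B
        ¬vq = ¬pq
        ¬vr : ¬ v ~ r
        ¬vr vr = sep~ ar vr qr
        ≢u : ∀ {z} → ¬ v ~ z → z ≢ u
        ≢u ¬vz refl = ¬vz vu
        ¬qu : ¬ q ~ u
        ¬qu qu = sep~ au vu qu
        near-qs : Near q s
        near-qs = [ (λ { (inj₁ s≡v) → ⊥-elim (s≢v s≡v) ; (inj₂ vs) → ⊥-elim (¬sv (~-sym vs)) }) , id ]′
                    (cover (~-sym sa))
        qs : q ~ s
        qs with near-qs
        ... | inj₁ refl = contradiction su ¬qu
        ... | inj₂ h    = h
        sq = ~-sym qs
        sr : s ~ r
        sr = Base.part-clique (base-sym B) (~-sym sa) ar near-qs (inj₂ qr) (r≢s ∘ sym)
        loose-sa : ¬ Tight s a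
        loose-sa t = ¬qu (t q u (sq , vq) (su , au) (≢u ¬vq))
        ¬ru : ¬ r ~ u
        ¬ru ru = <⇒≱ (cnt≥3 (common? s u) (~⇒≢ ax) (~⇒≢ ar) (λ { refl → ¬vr vx })
                       (sa , ~-sym au) (sx , ux) (sr , ~-sym ru))
                     (tight⇒common≤2 su tsu)
          where ux = tav u x (au , vu) (ax , vx) u≢x

      split : ∀ {p q} → Base a p q → Two a q → Near p v → ⊥
      split B two (inj₁ refl) = at-v B two
      -- The end `p` is tight with `a` and so differs from the loose neighbours `u` and `x`; the
      -- tight edge `a v` would have three common neighbours.
      split {p} B two (inj₂ pv) = <⇒≱
        (cnt≥3 (common? a v) u≢x (λ { refl → loose-au tight-p }) (λ { refl → loose-ax tight-p })
          (au , vu) (ax , vx) (vp , ~-sym pv))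
        (tight⇒common≤2 av tav)
        where open Base B

      finish : Frame a → ⊥
      finish (p , q , B , inj₁ tight) = loose-au (tight u au)
      finish (p , q , B , inj₂ (two-p , two-q , _)) =
        [ split B two-q , split (base-sym B) two-p ]′ (Base.cover B av)

    -- Tight neighbours within a line

    two-of-loose : v ~ u → ¬ Tight v u → v ~ a → Two v a
    two-of-loose {v} vu ¬t va with frame v
    ... | p , q , B , inj₁ tight = contradiction (tight _ vu) ¬t
    ... | p , q , B , inj₂ (two-p , two-q , _) =
      [ two-part B two-p va , two-part (base-sym B) two-q va ]′ (Base.cover B va)

    In : Fin n → Fin n → Pred (Fin n) 0ℓ
    In a v z = Near a z × Near v z

    in? : ∀ a v → Decidable (In a v)
    in? a v z = near? a z ×-dec near? v z

    TightIn : Fin n → Fin n → Fin n → Set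
    TightIn a v u = Σ (Fin n) λ w → In a v w × TightNbr u w

    -- The case where `a` and `v` lie in different parts at `u`. A further vertex `x` of the line
    -- that is not tight with `u` would be a third loose neighbour, so `Few u` fails and both ends
    -- have square degree at least 21. The end whose part contains `x` then contradicts
    -- `no-loose-corner`.
    tight-in-split : a ~ v → Tight a v → Common a v u → ¬ Tight u a → ¬ Tight u v →
      Base u s t → s ~ a → t ~ v → Few u ⊎ (21 ≤ degSq G s × 21 ≤ degSq G t) → TightIn a v u
    tight-in-split {a} {v} {u} {s} {t} av tav (au , vu) ¬tua ¬tuv B sa tv few⊎rich
      with x , x≢u , vx , ax ← two-other (two-of-loose vu (¬tuv ∘ tight-sym) (~-sym av)) u
      with tight? u x
    ... | yes tux = x , (inj₂ ax , inj₂ vx) , tav u x (au , vu) (ax , vx) (x≢u ∘ sym) , tux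
    ... | no ¬tux = ⊥-elim (absurd few⊎rich)
      where
      open Base B
      ux : u ~ x
      ux = tav u x (au , vu) (ax , vx) (x≢u ∘ sym)
      tight-t : Tight u t
      tight-t = Base.tight-p (base-sym B)
      ¬sv : ¬ s ~ v
      ¬sv sv = sep (~-sym vu) (inj₂ sv) (inj₂ tv)
      ¬ta : ¬ t ~ a
      ¬ta ta = sep (~-sym au) (inj₂ sa) (inj₂ ta)
      absurd : Few u ⊎ (21 ≤ degSq G s × 21 ≤ degSq G t) → ⊥
      absurd (inj₁ few-u) = few-u (~⇒≢ av) (~⇒≢ ax) (~⇒≢ vx) (~-sym au , ¬tua) (~-sym vu , ¬tuv) (ux , ¬tux)
      absurd (inj₂ (21≤s , 21≤t)) with cover ux
      ... | inj₁ (inj₁ refl) = ¬tux tight-p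
      ... | inj₁ (inj₂ sx) = no-loose-corner av tav (au , vu) (ax , vx) (x≢u ∘ sym)
              (~-sym vp) (tight-sym tight-p) sa sx (λ { refl → ¬tuv tight-p }) ¬sv 21≤s
      ... | inj₂ (inj₁ refl) = ¬tux tight-t
      ... | inj₂ (inj₂ tx) = no-loose-corner (~-sym av) (tight-sym tav) (vu , au) (vx , ax) (x≢u ∘ sym)
              (~-sym vq) (tight-sym tight-t) tv tx (λ { refl → ¬tua tight-t }) ¬ta 21≤t

    near⇒~ : s ≢ a → Near s a → s ~ a
    near⇒~ s≢a (inj₁ refl) = contradiction refl s≢a
    near⇒~ s≢a (inj₂ sa)   = sa

    tight-in-common : a ~ v → Tight a v → Common a v u → TightIn a v u
    tight-in-common {a} {v} {u} av tav (au , vu) with tight? u a | tight? u v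
    ... | yes tua | _       = a , (inj₁ refl , inj₂ (~-sym av)) , ~-sym au , tua
    ... | no _    | yes tuv = v , (inj₂ av , inj₁ refl) , ~-sym vu , tuv
    ... | no ¬tua | no ¬tuv with frame u
    ... | s , t , B , inj₁ tight = contradiction (tight a (~-sym au)) ¬tua
    ... | s , t , B , inj₂ (_ , _ , few⊎rich) with cover (~-sym au) | cover (~-sym vu)
      where open Base B
    -- When `a` and `v` lie in one part at `u`, the end of that part is itself on the line.
    ... | inj₁ sa | inj₁ sv = s , (near-sym sa , near-sym sv) , Base.vp B , Base.tight-p B
    ... | inj₂ ta | inj₂ tv = t , (near-sym ta , near-sym tv) , Base.vq B , Base.tight-p (base-sym B)
    ... | inj₁ sa | inj₂ tv = tight-in-split av tav (au , vu) ¬tua ¬tuv B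
            (near⇒~ (λ { refl → ¬tua (Base.tight-p B) }) sa)
            (near⇒~ (λ { refl → ¬tuv (Base.tight-p (base-sym B)) }) tv) few⊎rich
    ... | inj₂ ta | inj₁ sv = tight-in-split av tav (au , vu) ¬tua ¬tuv (base-sym B)
            (near⇒~ (λ { refl → ¬tua (Base.tight-p (base-sym B)) }) ta)
            (near⇒~ (λ { refl → ¬tuv (Base.tight-p B) }) sv) (⊎-map₂ swap few⊎rich)

    tight-in : a ~ v → Tight a v → In a v u → TightIn a v u
    tight-in {a} {v} av tav (inj₁ refl , _)         = v , (inj₂ av , inj₁ refl) , av , tav
    tight-in {a} {v} av tav (inj₂ au , inj₁ refl)   = a , (inj₁ refl , inj₂ (~-sym av)) , ~-sym av , tight-sym tav
    tight-in av tav (inj₂ au , inj₂ vu) = tight-in-common av tav (au , vu)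

    in-near : Tight a v → In a v x → In a v y → Near x y
    in-near t (inj₁ refl , _)      (ay , _)             = ay
    in-near t (inj₂ _ , inj₁ refl) (_ , vy)             = vy
    in-near t (ax , _)             (inj₁ refl , _)      = near-sym ax
    in-near t (_ , vx)             (inj₂ _ , inj₁ refl) = near-sym vx
    in-near {x = x} {y} t (inj₂ ax , inj₂ vx) (inj₂ ay , inj₂ vy) with y ≟ x
    ... | yes y≡x = inj₁ y≡x
    ... | no y≢x  = inj₂ (t x y (ax , vx) (ay , vy) (y≢x ∘ sym))

    -- Any tight pair on a line determines it. The line of `a v` is a clique, so its vertices are
    -- near `u` and `w`. Conversely `a` and `v` lie on the line of `u w`, which is a clique as well.
    same-line : Tight a v → Tight u w → In a v u → In a v w → ∀ z → In a v z ⇔ In u w z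
    same-line {a} {v} tav tuw u∈ w∈ z = mk⇔
      (λ z∈ → in-near tav u∈ z∈ , in-near tav w∈ z∈)
      (λ z∈ → in-near tuw (near-sym (proj₁ u∈) , near-sym (proj₁ w∈)) z∈
            , in-near tuw (near-sym (proj₂ u∈) , near-sym (proj₂ w∈)) z∈)

    -- The root graph: its vertices are (codes of) subsets of V(G), and the
    -- edge φ x joins the two lines through x.

    end : Fin n → Bool → Fin n
    end x true  = proj₁ (frame x)
    end x false = proj₁ (proj₂ (frame x))

    -- Indexing the ends by `Bool` lets `not` exchange the two parts, so that later arguments treat
    -- both at once.
    base : ∀ x b → Base x (end x b) (end x (not b))
    base x true  = proj₁ (proj₂ (proj₂ (frame x)))
    base x false = base-sym (proj₁ (proj₂ (proj₂ (frame x))))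

    line : Fin n → Bool → Fin (2 ^ n)
    line x b = code (in? x (end x b))

    tight-end : ∀ x b → Tight x (end x b)
    tight-end x b = Base.tight-p (base x b)

    -- By `tight-in` the line contains a tight neighbour `w` of `x`, which lies in the part of some
    -- `end x b`. Two uses of `same-line` pass from `a v` to `x w` and on to the edge from `x` to
    -- this end.
    line-through : a ~ v → Tight a v → In a v x → Σ Bool λ b → code (in? a v) ≡ line x b
    line-through {a} {v} {x} av tav x∈ with w , w∈ , xw , txw ← tight-in av tav x∈ =
      [ along true , along false ]′ (Base.cover (base x true) xw)
      where
      along : ∀ b → Near (end x b) w → Σ Bool λ b → code (in? a v) ≡ line x b
      along b near = b , code-cong (in? a v) (in? x (end x b)) λ z →
        ⇔-trans (same-line tav txw x∈ w∈ z)
                (same-line txw (tight-end x b) (inj₁ refl , inj₂ (~-sym xw))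
                   (inj₂ (Base.vp (base x b)) , near-sym near) z)

    self-in : ∀ x b → In x (end x b) x
    self-in x b = inj₁ refl , inj₂ (~-sym (Base.vp (base x b)))

    line-mem : ∀ b c → line x b ≡ line y c → In x (end x b) y
    line-mem {x} {y} b c eq = code-injective (in? y (end y c)) (in? x (end x b)) (sym eq) (self-in y c)

    line-near : ∀ b c → line x b ≡ line y c → Near x y
    line-near b c eq = proj₁ (line-mem b c eq)

    -- A vertex other than `x` on both lines of `x` would be a neighbour of `x` near both ends,
    -- against `sep`.
    lines-meet-once : ∀ b c → line x b ≡ line y c → line x (not b) ≡ line y (not c) → x ≡ y
    lines-meet-once {x} b c eq eq′ with line-mem b c eq | line-mem (not b) (not c) eq′
    ... | inj₁ y≡x , _  | _       = sym y≡x
    ... | inj₂ xy  , near | _ , near′ = ⊥-elim (Base.sep (base x b) xy near near′)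

    lines-distinct : ∀ x b → line x b ≢ line x (not b)
    lines-distinct x b eq = Base.sep (base x b) (Base.vp (base x b)) (inj₁ refl)
      (proj₂ (code-injective (in? x (end x b)) (in? x (end x (not b))) eq
        (inj₂ (Base.vp (base x b)) , inj₁ refl)))

    φ : Fin n → Fin (2 ^ n) × Fin (2 ^ n)
    φ x = line x true , line x false

    sameEdge? : ∀ x c d → Dec (SameEdge (φ x) (c , d))
    sameEdge? x c d = ((line x true ≟ c) ×-dec (line x false ≟ d)) ⊎-dec ((line x true ≟ d) ×-dec (line x false ≟ c))

    edge? : ∀ c d → Dec (Σ (Fin n) λ x → SameEdge (φ x) (c , d))
    edge? c d = any? λ x → sameEdge? x c d

    φ-injective : ∀ x y → SameEdge (φ x) (φ y) → x ≡ y
    φ-injective x y (inj₁ (eq , eq′)) = lines-meet-once true true eq eq′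
    φ-injective x y (inj₂ (eq , eq′)) = lines-meet-once true false eq eq′

    root : Graph (2 ^ n)
    root = record
      { adj    = λ c d → does (edge? c d)
      ; sym    = λ c d → does-⇔ (mk⇔ (λ (x , e) → x , ⊎-swap e) (λ (x , e) → x , ⊎-swap e)) (edge? c d) (edge? d c)
      ; irrefl = λ c → dec-false (edge? c c) λ
          { (x , inj₁ (refl , eq)) → lines-distinct x true (sym eq)
          ; (x , inj₂ (refl , eq)) → lines-distinct x true (sym eq) } }

    isLineGraph : IsLineGraphOf G root
    isLineGraph = φ
      , (λ x → does⁺ (edge? _ _) (x , inj₁ (refl , refl)))
      , (λ c d → does⁻ (edge? c d))
      , φ-injective
      , (λ x y xy → ~⇒≢ xy , [ share xy true , share xy false ]′ (Base.cover (base x true) xy))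
      , λ x y x≢y → λ
          { (inj₁ eq)               → near⇒~ x≢y (line-near true  true  eq)
          ; (inj₂ (inj₁ eq))        → near⇒~ x≢y (line-near true  false eq)
          ; (inj₂ (inj₂ (inj₁ eq))) → near⇒~ x≢y (line-near false true  eq)
          ; (inj₂ (inj₂ (inj₂ eq))) → near⇒~ x≢y (line-near false false eq) }
      where
      shareEnd : ∀ b c → line x b ≡ line y c → ShareEnd (φ x) (φ y)
      shareEnd true  true  = inj₁
      shareEnd true  false = inj₂ ∘ inj₁
      shareEnd false true  = inj₂ ∘ inj₂ ∘ inj₁
      shareEnd false false = inj₂ ∘ inj₂ ∘ inj₂
      share : x ~ y → ∀ b → Near (end x b) y → ShareEnd (φ x) (φ y)
      -- `y` is on the line of `x` with index `b`, and `line-through` recognises this line as one of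
      -- the two through `y`.
      share {x} xy b near with c , eq ← line-through (Base.vp (base x b)) (tight-end x b) (inj₂ xy , near) =
        shareEnd b c eq

    -- Degrees in the root graph

    Through : Fin (2 ^ n) → Pred (Fin n) 0ℓ
    Through c x = line x true ≡ c ⊎ line x false ≡ c

    through? : ∀ c → Decidable (Through c)
    through? c x = (line x true ≟ c) ⊎-dec (line x false ≟ c)

    through-clique : ∀ c → Clique (Through c)
    through-clique c x y (inj₁ refl) (inj₁ eq) x≢y = near⇒~ x≢y (line-near true  true  (sym eq))
    through-clique c x y (inj₁ refl) (inj₂ eq) x≢y = near⇒~ x≢y (line-near true  false (sym eq))
    through-clique c x y (inj₂ refl) (inj₁ eq) x≢y = near⇒~ x≢y (line-near false true  (sym eq))
    through-clique c x y (inj₂ refl) (inj₂ eq) x≢y = near⇒~ x≢y (line-near false false (sym eq))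

    edge⇒through : ∀ {c d} x → SameEdge (φ x) (c , d) → Through c x
    edge⇒through x (inj₁ (eq , _)) = inj₁ eq
    edge⇒through x (inj₂ (_ , eq)) = inj₂ eq

    other-end-unique : ∀ {c d d′} x → SameEdge (φ x) (c , d) → SameEdge (φ x) (c , d′) → d ≡ d′
    other-end-unique x (inj₁ (_ , refl)) (inj₁ (_ , eq)) = eq
    other-end-unique x (inj₂ (refl , _)) (inj₂ (eq , _)) = eq
    other-end-unique x (inj₁ (refl , _)) (inj₂ (_ , eq)) = contradiction (sym eq) (lines-distinct x true)
    other-end-unique x (inj₂ (_ , refl)) (inj₁ (eq , _)) = contradiction eq (lines-distinct x true)

    edge-unique : ∀ {c d} x y → SameEdge (φ x) (c , d) → SameEdge (φ y) (c , d) → x ≡ y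
    edge-unique x y e (inj₁ (refl , refl)) = φ-injective x y e
    edge-unique x y e (inj₂ (refl , refl)) = φ-injective x y (⊎-swap e)

    -- An edge of the root at `c` comes from a vertex on the line `c`, and this vertex determines
    -- its other end; the vertices on a line form a clique.
    deg≤4 : ∀ c → deg root c ≤ 4
    deg≤4 c = ≤-trans
      (*-cancelˡ-≤ 1 (double-count 1 1 (λ x d → sameEdge? x c d) (edge? c) (through? c)
        (λ d (x , e) → cnt≥1 (λ x → sameEdge? x c d) x e)
        (λ x d → edge⇒through x)
        (λ x _ → ≮⇒≥ λ lt → let d , d′ , d≢d′ , e , e′ = pick₂ (sameEdge? x c) lt in
                              d≢d′ (other-end-unique x e e′))))
      (clique≤4 (through? c) (through-clique c))

    through≤deg : ∀ c → cnt (through? c) ≤ deg root c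
    through≤deg c = *-cancelˡ-≤ 1 (double-count 1 1 (λ d x → sameEdge? x c d) (through? c) (edge? c)
      (λ { x (inj₁ eq) → cnt≥1 (sameEdge? x c) (line x false) (inj₁ (eq , refl))
         ; x (inj₂ eq) → cnt≥1 (sameEdge? x c) (line x true)  (inj₂ (refl , eq)) })
      (λ d x e → x , e)
      (λ d _ → ≮⇒≥ λ lt → let x , y , x≢y , e , e′ = pick₂ (λ x → sameEdge? x c d) lt in
                            x≢y (edge-unique x y e e′)))

    -- If all edges at a vertex of the K₄ are tight, an edge of the K₄ there spans a line with the
    -- other two vertices. Otherwise the frame supplies two common neighbours through `Two`.
    big-line : HasClique G 4 → Σ (Fin n) λ v → Σ (Fin n) λ p → v ~ p × Tight v p × Two v p
    big-line (f , inj , cl) with frame (f 0F)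
    ... | p , q , B , inj₂ (two-p , _) = f 0F , p , Base.vp B , Base.tight-p B , two-p
    ... | p , q , B , inj₁ tight = f 0F , f 1F , cl 0F 1F (λ ()) , tight (f 1F) (cl 0F 1F λ ())
        , f 2F , f 3F , ~⇒≢ (cl 2F 3F λ ()) , (cl 0F 2F (λ ()) , cl 1F 2F λ ()) , (cl 0F 3F (λ ()) , cl 1F 3F λ ())

    maxDegree : HasClique G 4 → MaxDegree root 4
    maxDegree K₄ with v , p , vp , tvp , x , y , x≢y , (vx , px) , (vy , py) ← big-line K₄ =
      deg≤4 , c , ≤-antisym (deg≤4 c) (≤-trans
        (cnt≥length (through? c) (v ∷ p ∷ x ∷ y ∷ [])
          ((~⇒≢ vp ∷ ~⇒≢ vx ∷ ~⇒≢ vy ∷ []) ∷ (~⇒≢ px ∷ ~⇒≢ py ∷ []) ∷ (x≢y ∷ []) ∷ [] ∷ [])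
          (on (inj₁ refl , inj₂ (~-sym vp)) ∷ on (inj₂ vp , inj₁ refl)
            ∷ on (inj₂ vx , inj₂ px) ∷ on (inj₂ vy , inj₂ py) ∷ []))
        (through≤deg c))
      where
      c = code (in? v p)
      on : In v p z → Through c z
      on z∈ with line-through vp tvp z∈
      ... | true  , eq = inj₁ (sym eq)
      ... | false , eq = inj₂ (sym eq)

  -- Alternative (ii) or a frame at each vertex

  Reducible : Fin n → Set
  Reducible v = degSq G v ≤ 19 ×
    (∀ x y → v ~ x → v ~ y → degSq G x ≥ 21 → degSq G y ≥ 21 → x ≢ y → sqDelAdj G v x y)

  sqDelAdj? : ∀ v x y → Dec (sqDelAdj G v x y)
  sqDelAdj? v x y = ¬? (x ≟ y) ×-dec ((x ~? y) ⊎-dec any? λ w → ¬? (w ≟ v) ×-dec (x ~? w) ×-dec (w ~? y))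

  -- Square degree at least 20 gives a frame. Below that only the clique condition can fail, and a
  -- search finds a violating pair or shows that there is none.
  frame⊎reducible : ∀ v → Frame v ⊎ Reducible v
  frame⊎reducible v with 20 ≤? degSq G v
  ... | yes 20≤ = inj₁ (20≤degSq⇒frame 20≤)
  ... | no ¬20≤ with any? (λ x → any? λ y → (v ~? x) ×-dec (v ~? y) ×-dec (21 ≤? degSq G x) ×-dec
                               (21 ≤? degSq G y) ×-dec ¬? (x ≟ y) ×-dec ¬? (sqDelAdj? v x y))
  ...   | yes (x , y , vx , vy , 21≤x , 21≤y , x≢y , ¬sq) = inj₁ (bad-pair⇒frame vx vy 21≤x 21≤y x≢y ¬sq)
  ...   | no ¬bad = inj₂ (s≤s⁻¹ (≰⇒> ¬20≤) , λ x y vx vy 21≤x 21≤y x≢y →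
            decidable-stable (sqDelAdj? v x y) λ ¬sq → ¬bad (x , y , vx , vy , 21≤x , 21≤y , x≢y , ¬sq))

theorem5p3 : ∀ {n} (G : Graph n) → Connected G → ClawFree G → CliqueNumber G 4 →
    (Σ ℕ λ m → Σ (Graph m) λ F → MaxDegree F 4 × IsLineGraphOf G F)
    ⊎ (Σ (Fin n) λ v → degSq G v ≤ 19 ×
    (∀ x y → Adj G v x → Adj G v y → degSq G x ≥ 21 → degSq G y ≥ 21 →
    x ≢ y → sqDelAdj G v x y))
theorem5p3 {n} G _ claw-free (K₄ , no-K₅) = ⊎-map₁
  (λ frame → let open Framed frame in 2 ^ n , root , maxDegree K₄ , isLineGraph)
  (all⊎any frame⊎reducible)
  where open Claw-free-without-K₅ G claw-free no-K₅
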